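{- Let $a_{XY}$, where $X,Y\in\{\mathtt{L},\mathtt{S},\mathtt{W}\}$, be arbitrary positive integers (nine in total) and let $$n=\prod_{X,Y\in\{\mathtt{L},\mathtt{S},\mathtt{W}\}}a_{XY}+1.$$ Then every ordered $3$-uniform matching $M$ on $3n$ vertices either contains a semi-line of size $a_{\mathtt{LL}}+1$, or there exists $(X,Y)\neq(\mathtt{L},\mathtt{L})$ such that $M$ contains a sub-matching of $a_{XY}+1$ triples every two of which are in relation $\mathcal{R}_{XY}$.
   Context: An ordered $3$-uniform matching on $3n$ vertices is a family of $n$ pairwise disjoint $3$-element subsets (triples) of a linearly ordered set of $3n$ elements, say $\{1,\dots,3n\}$ (so every vertex is covered). The size of a matching is its number of triples; a sub-matching is a subfamily of its triples. Given two disjoint triples, let $A$ denote the one containing the smallest of the six vertices and $B$ the other one. Reading the six vertices in increasing order and writing the letter of the triple each belongs to yields a word of length $6$ with three $A$'s and three $B$'s, starting with $A$. There are ten such words, and they define the following relations between two triples: $\mathcal{R}_{\mathtt{LL}}$: $AAABBB$ (an alignment); $\mathcal{R}^*_{\mathtt{LL}}$: $AABABB$ (an engagement); $\mathcal{R}_{\mathtt{LS}}$: $AABBBA$; $\mathcal{R}_{\mathtt{LW}}$: $AABBAB$; $\mathcal{R}_{\mathtt{SL}}$: $ABBBAA$; $\mathcal{R}_{\mathtt{SS}}$: $ABBAAB$; $\mathcal{R}_{\mathtt{SW}}$: $ABBABA$; $\mathcal{R}_{\mathtt{WL}}$: $ABAABB$; $\mathcal{R}_{\mathtt{WS}}$: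 $ABABBA$; $\mathcal{R}_{\mathtt{WW}}$: $ABABAB$. A semi-line is an ordered $3$-uniform matching in which every pair of triples is in relation $\mathcal{R}_{\mathtt{LL}}$ or $\mathcal{R}^*_{\mathtt{LL}}$. A matching contains a semi-line if some sub-matching of it is a semi-line. -}

module Defs where

open import Data.Fin using (Fin)
open import Data.Fin.Subset using (Subset; inside; outside; ∣_∣; _∈_; _∩_; Empty)
open import Data.List using (List; []; _∷_; product; cartesianProductWith)
open import Data.Nat using (ℕ; _*_)
open import Data.Product using (Σ-syntax; _×_)
open import Data.Sum using (_⊎_)
open import Data.Vec using ([]; _∷_)
open import Relation.Binary.Core using (Rel)
open import Relation.Binary.PropositionalEquality using (_≡_; _≢_)
open import Level using (0ℓ)

record Matching (n : ℕ) : Set where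
  field
    triple   : Fin n → Subset (3 * n)
    size     : ∀ i → ∣ triple i ∣ ≡ 3
    disjoint : ∀ {i j} → i ≢ j → Empty (triple i ∩ triple j)

open Matching public

data Letter : Set where
  A B : Letter

Word : Set
Word = List Letter

-- The vertices of p ∪ q in increasing order, lettered A for p and B for q.
-- Only meant for disjoint p and q: a common vertex would be lettered A.
word : ∀ {m} → Subset m → Subset m → Word
word []            []            = []
word (inside  ∷ p) (_       ∷ q) = A ∷ word p q
word (outside ∷ p) (inside  ∷ q) = B ∷ word p q
word (outside ∷ p) (outside ∷ q) = word p q

-- The relation on unordered pairs given by a word.  All words used below start
-- with A, so the disjunct that holds is the one in which the triple with the
-- smallest vertex is lettered A.
Related : ∀ {m} → Word → Rel (Subset m) 0ℓ
Related w p q = word p q ≡ w ⊎ word q p ≡ w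

data Shape : Set where
  L S W : Shape

pattern-word : Shape → Shape → Word
pattern-word L L = A ∷ A ∷ A ∷ B ∷ B ∷ B ∷ []
pattern-word L S = A ∷ A ∷ B ∷ B ∷ B ∷ A ∷ []
pattern-word L W = A ∷ A ∷ B ∷ B ∷ A ∷ B ∷ []
pattern-word S L = A ∷ B ∷ B ∷ B ∷ A ∷ A ∷ []
pattern-word S S = A ∷ B ∷ B ∷ A ∷ A ∷ B ∷ []
pattern-word S W = A ∷ B ∷ B ∷ A ∷ B ∷ A ∷ []
pattern-word W L = A ∷ B ∷ A ∷ A ∷ B ∷ B ∷ []
pattern-word W S = A ∷ B ∷ A ∷ B ∷ B ∷ A ∷ []
pattern-word W W = A ∷ B ∷ A ∷ B ∷ A ∷ B ∷ []

engagement-word : Word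
engagement-word = A ∷ A ∷ B ∷ A ∷ B ∷ B ∷ []

R : Shape → Shape → ∀ {m} → Rel (Subset m) 0ℓ
R X Y = Related (pattern-word X Y)

R*LL : ∀ {m} → Rel (Subset m) 0ℓ
R*LL = Related engagement-word

-- A sub-matching of M is given by the set of indices of its triples.
SubMatching : ∀ {n} → Matching n → Set
SubMatching {n} _ = Subset n

EveryTwo : ∀ {n} (M : Matching n) → Rel (Subset (3 * n)) 0ℓ → SubMatching M → Set
EveryTwo M _~_ N = ∀ {i j} → i ∈ N → j ∈ N → i ≢ j → triple M i ~ triple M j

IsSemiLine : ∀ {n} (M : Matching n) → SubMatching M → Set
IsSemiLine M = EveryTwo M (λ p q → R L L p q ⊎ R*LL p q)

ContainsOfSize : ∀ {n} (M : Matching n) → ℕ → (SubMatching M → Set) → Set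
ContainsOfSize M k P = Σ[ N ∈ SubMatching M ] (∣ N ∣ ≡ k × P N)

shapes : List Shape
shapes = L ∷ S ∷ W ∷ []

∏ : (Shape → Shape → ℕ) → ℕ
∏ a = product (cartesianProductWith a shapes shapes)

{-# OPTIONS --safe #-}

-- Cut each triple x < y < z into the edges xy and yz.  Two disjoint triples
-- are in relation R X Y (or R*LL when X = Y = L) as soon as their xy-edges have
-- shape X and their yz-edges have shape Y.  Hence it suffices to apply twice the
-- Erdős–Szekeres theorem for ordered graph matchings: first to the xy-edges,
-- with the bound for shape X being the product of the a X Y over Y, and then to
-- the yz-edges of the triples obtained.
module Submission where

open import Defs
open import Data.Empty using (⊥-elim)
open import Data.Fin using (Fin; zero; suc)
open import Data.Fin.Subset using (Subset; inside; outside; ∣_∣; Nonempty; Empty; _∩_)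
  renaming (_∈_ to _∈ˢ_; _∉_ to _∉ˢ_; ⊥ to ∅)
open import Data.Fin.Subset.Properties using (∣⊥∣≡0; ∉⊥)
open import Data.List using (List; []; _∷_; length; filter; take; allFin)
open import Data.List.Membership.Propositional using (_∈_; lose; find)
open import Data.List.Membership.Propositional.Properties
  using (∈-filter⁻; ∈-++⁺ˡ)
open import Data.List.Properties using (length-take; take++drop≡id; length-tabulate)
open import Data.List.Relation.Binary.Subset.Propositional using (_⊆_)
open import Data.List.Relation.Unary.All as All using (All; []; _∷_)
open import Data.List.Relation.Unary.AllPairs as AllPairs using (AllPairs; []; _∷_)
open import Data.List.Relation.Unary.Any using (Any; here; there; any?)
open import Data.List.Relation.Unary.Unique.Propositional using (Unique)
import Data.List.Relation.Unary.Unique.Propositional.Properties as Unique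
open import Data.Nat using (ℕ; zero; suc; _+_; _*_; _<_; _≤_; _>_; _<?_)
open import Data.Nat.Properties using
  ( ≤-refl; ≤-reflexive; <⇒≤; ≮⇒≥; ≤∧≢⇒<; <-trans; <-asym; <-irrefl; <-cmp; m≤n⇒m⊓n≡m
  ; +-suc; +-comm; +-cancelˡ-<; +-monoʳ-≤; *-assoc; *-identityʳ; module ≤-Reasoning )
open import Data.Product using (Σ-syntax; ∃; ∃₂; _×_; _,_; proj₁)
open import Data.Sum using (_⊎_; inj₁; inj₂; [_,_]′; swap)
import Data.Sum as Sum
open import Data.Vec using ([]; _∷_; here; there; _[_]≔_)
open import Function using (_∘_; id; _$_)
open import Level using (0ℓ)
open import Relation.Binary.Core using (Rel)
open import Relation.Binary.Definitions using (Transitive; Irreflexive; Decidable; tri<; tri≈; tri>)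
open import Relation.Binary.PropositionalEquality
  using (_≡_; _≢_; refl; sym; trans; cong; subst; ≢-sym; module ≡-Reasoning)
open import Relation.Nullary using (¬_; yes; no)
open import Relation.Nullary.Decidable using (_×-dec_)
open import Relation.Unary using () renaming (Decidable to Decidable₁)
open import Relation.Unary.Properties using (∁?)

private
  variable
    I : Set
    m n : ℕ

-- Cliques, chains and antichains

-- Cliques are taken inside a list, so that the members of one can be the ground list of the next
-- search.
record Clique {I : Set} (_~_ : Rel I 0ℓ) (k : ℕ) (xs : List I) : Set where
  field
    members : List I
    unique  : Unique members
    within  : members ⊆ xs
    length≡ : length members ≡ k
    related : ∀ {i j} → i ∈ members → j ∈ members → i ≢ j → i ~ j

open Clique

clique-take : {_~_ : Rel I 0ℓ} {xs ys : List I} (k : ℕ) →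
  Unique ys → ys ⊆ xs → k ≤ length ys →
  (∀ {i j} → i ∈ ys → j ∈ ys → i ≢ j → i ~ j) → Clique _~_ k xs
clique-take {ys = ys} k u ys⊆xs k≤ rel = record
  { members = take k ys
  ; unique  = Unique.take⁺ k u
  ; within  = ys⊆xs ∘ take⊆
  ; length≡ = trans (length-take k ys) (m≤n⇒m⊓n≡m k≤)
  ; related = λ i∈ j∈ → rel (take⊆ i∈) (take⊆ j∈)
  }
  where
  take⊆ : take k ys ⊆ ys
  take⊆ i∈ = subst (_ ∈_) (take++drop≡id k ys) (∈-++⁺ˡ i∈)

clique-map : {_~_ _≈_ : Rel I 0ℓ} {k : ℕ} {xs xs′ : List I} → xs ⊆ xs′ →
  (c : Clique _~_ k xs) →
  (∀ {i j} → i ∈ members c → j ∈ members c → i ≢ j → i ~ j → i ≈ j) →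
  Clique _≈_ k xs′
clique-map xs⊆xs′ c f = record
  { members = members c
  ; unique  = unique c
  ; within  = xs⊆xs′ ∘ within c
  ; length≡ = length≡ c
  ; related = λ i∈ j∈ i≢j → f i∈ j∈ i≢j (related c i∈ j∈ i≢j)
  }

AllPairs-related : {_~_ : Rel I 0ℓ} {xs : List I} → AllPairs _~_ xs →
  ∀ {i j} → i ∈ xs → j ∈ xs → i ≢ j → i ~ j ⊎ j ~ i
AllPairs-related (_  ∷ _)  (here refl) (here refl) i≢j = ⊥-elim (i≢j refl)
AllPairs-related (x~ ∷ _)  (here refl) (there j∈)  _   = inj₁ (All.lookup x~ j∈)
AllPairs-related (x~ ∷ _)  (there i∈)  (here refl) _   = inj₂ (All.lookup x~ i∈)
AllPairs-related (_  ∷ ps) (there i∈)  (there j∈)  i≢j = AllPairs-related ps i∈ j∈ i≢j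

length-filter-∁ : {P : I → Set} (P? : Decidable₁ P) (xs : List I) →
  length (filter P? xs) + length (filter (∁? P?) xs) ≡ length xs
length-filter-∁ P? [] = refl
length-filter-∁ P? (x ∷ xs) with P? x
... | yes _ = cong suc (length-filter-∁ P? xs)
... | no  _ = trans (+-suc _ _) (cong suc (length-filter-∁ P? xs))

module _ {_≺_ : Rel I 0ℓ}
  (≺-trans : Transitive _≺_) (≺-irrefl : Irreflexive _≡_ _≺_) (_≺?_ : Decidable _≺_) where

  Comparable Incomparable : Rel I 0ℓ
  Comparable   i j = i ≺ j ⊎ j ≺ i
  Incomparable i j = ¬ i ≺ j × ¬ j ≺ i

  private
    -- The least element `c` is kept apart, ready to be extended downwards; `a` counts the others,
    -- so the chain has `a + 1` elements.
    Chain : ℕ → List I → Set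
    Chain a xs = Σ[ c ∈ I ] Σ[ cs ∈ List I ]
      (AllPairs _≺_ (c ∷ cs) × All (_∈ xs) (c ∷ cs) × length cs ≡ a)

    nonminimal? : (xs : List I) → Decidable₁ (λ x → Any (_≺ x) xs)
    nonminimal? xs x = any? (_≺? x) xs

    minimal nonminimal : List I → List I
    minimal    xs = filter (∁? (nonminimal? xs)) xs
    nonminimal xs = filter (nonminimal? xs) xs

    -- Induction on a, removing the minimal elements: a chain among the others
    -- can be prolonged downwards.
    chain-or-antichain′ : ∀ a b xs → Unique xs → a * b < length xs →
      Chain a xs ⊎ Clique Incomparable (suc b) xs
    -- Here `a * b` is 0, so the list is nonempty and any one element is a chain.
    chain-or-antichain′ zero b (x ∷ xs) _ _ =
      inj₁ (x , [] , [] ∷ [] , here refl ∷ [] , refl)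
    chain-or-antichain′ (suc a) b xs u ab< with b <? length (minimal xs)
    ... | yes b< = inj₂ $ clique-take (suc b) (Unique.filter⁺ _ u) (proj₁ ∘ ∈-filter⁻ _) b<
      -- If `i ≺ j`, then `i` would be an element of `xs` below the minimal `j`.
      λ i∈ j∈ _ →
        let i∈xs , ¬≺i = ∈-filter⁻ (∁? (nonminimal? xs)) {xs = xs} i∈
            j∈xs , ¬≺j = ∈-filter⁻ (∁? (nonminimal? xs)) {xs = xs} j∈
        in (λ i≺j → ¬≺j (lose i∈xs i≺j)) , (λ j≺i → ¬≺i (lose j∈xs j≺i))
    ... | no b≮ = Sum.map prolong (λ c → clique-map (proj₁ ∘ ∈-filter⁻ _) c λ _ _ _ → id)
      (chain-or-antichain′ a b (nonminimal xs) (Unique.filter⁺ _ u) ab<nonminimal)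
      where
      ab<nonminimal : a * b < length (nonminimal xs)
      -- At most `b` minimal elements are lost, and `suc a * b` is `b + a * b`, which pays for
      -- exactly that many.
      ab<nonminimal = +-cancelˡ-< b _ _ $ begin-strict
        b + a * b                                       <⟨ ab< ⟩
        length xs                                       ≡⟨ length-filter-∁ (nonminimal? xs) xs ⟨
        length (nonminimal xs) + length (minimal xs)    ≤⟨ +-monoʳ-≤ _ (≮⇒≥ b≮) ⟩
        length (nonminimal xs) + b                      ≡⟨ +-comm _ b ⟩
        b + length (nonminimal xs)                      ∎
        where open ≤-Reasoning

      prolong : Chain a (nonminimal xs) → Chain (suc a) xs
      prolong (c , cs , c≺cs ∷ chain , c∈ ∷ cs∈ , len) =
        -- `c` is not minimal in `xs`, so `xs` itself supplies some `d` below it.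
        let c∈xs , below-c = ∈-filter⁻ (nonminimal? xs) c∈
            d , d∈xs , d≺c = find below-c
        in d , c ∷ cs
             , (d≺c ∷ All.map (≺-trans d≺c) c≺cs) ∷ c≺cs ∷ chain
             , d∈xs ∷ c∈xs ∷ All.map (proj₁ ∘ ∈-filter⁻ (nonminimal? xs)) cs∈
             , cong suc len

  chain-or-antichain : ∀ a b xs → Unique xs → a * b < length xs →
    Clique Comparable (suc a) xs ⊎ Clique Incomparable (suc b) xs
  chain-or-antichain a b xs u ab< = Sum.map₁ clique (chain-or-antichain′ a b xs u ab<)
    where
    clique : Chain a xs → Clique Comparable (suc a) xs
    clique (c , cs , chain , ∈xs , len) = record
      { members = c ∷ cs
      -- An entry repeated in the chain would precede itself.
      ; unique  = AllPairs.map (λ i≺j i≡j → ≺-irrefl i≡j i≺j) chain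
      ; within  = All.lookup ∈xs
      ; length≡ = cong suc len
      ; related = AllPairs-related chain
      }

-- The Erdős–Szekeres theorem for ordered graph matchings

record Edge : Set where
  constructor edge
  field
    {left right} : ℕ
    left<right   : left < right

open Edge

infix 4 _⟨_⟩_ _~⟨_⟩_

-- `L` is separation, `S` nesting and `W` crossing (lines, stacks and waves); `e` is always the edge
-- with the smaller left end.
_⟨_⟩_ : Edge → Shape → Edge → Set
e ⟨ L ⟩ f = right e < left f
e ⟨ S ⟩ f = left e < left f × right f < right e
e ⟨ W ⟩ f = left e < left f × left f < right e × right e < right f

_~⟨_⟩_ : Edge → Shape → Edge → Set
e ~⟨ X ⟩ f = e ⟨ X ⟩ f ⊎ f ⟨ X ⟩ e

record DisjointEdges (e f : Edge) : Set where
  field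
    ll : left e ≢ left f
    lr : left e ≢ right f
    rl : right e ≢ left f
    rr : right e ≢ right f

-- Crossing is not transitive, so W is reached by elimination.
incomparable⇒W : ∀ {e f} → DisjointEdges e f →
  ¬ e ⟨ L ⟩ f × ¬ f ⟨ L ⟩ e → ¬ e ⟨ S ⟩ f × ¬ f ⟨ S ⟩ e → e ~⟨ W ⟩ f
incomparable⇒W {e} {f} d (¬ef , ¬fe) (¬e⊃f , ¬f⊃e) with <-cmp (left e) (left f)
-- Once `e` starts first, the failure of `L` and of `S` gives the other two comparisons weakly;
-- disjointness makes them strict.
... | tri< l< _ _ = inj₁ (l< , ≤∧≢⇒< (≮⇒≥ ¬ef) (≢-sym rl) , ≤∧≢⇒< (≮⇒≥ (¬e⊃f ∘ (l< ,_))) rr)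
  where open DisjointEdges d
... | tri≈ _ l≡ _ = ⊥-elim (DisjointEdges.ll d l≡)
... | tri> _ _ l> = inj₂ (l> , ≤∧≢⇒< (≮⇒≥ ¬fe) lr , ≤∧≢⇒< (≮⇒≥ (¬f⊃e ∘ (l> ,_))) (≢-sym rr))
  where open DisjointEdges d

module _ (e : I → Edge) (disjoint-edges : ∀ {i j} → i ≢ j → DisjointEdges (e i) (e j)) where

  private
    Before : Shape → Rel I 0ℓ
    Before X i j = e i ⟨ X ⟩ e j

  -- Separation and nesting are both strict partial orders. Without a long `L`-chain there is an
  -- `L`-antichain of more than `s S * s W` edges; inside it lies either a long `S`-chain or an
  -- antichain for both orders, where all pairs cross.
  homogeneous-clique : (s : Shape → ℕ) (xs : List I) → Unique xs →
    s L * (s S * s W) < length xs →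
    ∃ λ X → Clique (λ i j → e i ~⟨ X ⟩ e j) (suc (s X)) xs
  homogeneous-clique s xs u s<
    with chain-or-antichain {_≺_ = Before L} L-trans (λ { {i} refl → <-asym (left<right (e i)) })
           (λ _ _ → _ <? _) (s L) (s S * s W) xs u s<
    where
    L-trans : Transitive (Before L)
    L-trans {j = j} ij jk = <-trans ij (<-trans (left<right (e j)) jk)
  ... | inj₁ c = L , c
  ... | inj₂ c
    with chain-or-antichain {_≺_ = Before S}
           (λ (l< , r<) (l<′ , r<′) → <-trans l< l<′ , <-trans r<′ r<)
           (λ { refl (l< , _) → <-irrefl refl l< })
           (λ _ _ → (_ <? _) ×-dec (_ <? _))
           -- `c` has exactly `suc (s S * s W)` members, just what the second search requires.
           (s S) (s W) (members c) (unique c) (≤-reflexive (sym (length≡ c)))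
  ... | inj₁ d = S , clique-map (within c) d λ _ _ _ → id
  ... | inj₂ d = W , clique-map (within c) d λ i∈ j∈ i≢j →
    incomparable⇒W (disjoint-edges i≢j) (related c (within d i∈) (within d j∈) i≢j)

-- Words of pairs of triples

-- An interleaving with its comparisons recorded: the word of two triples can be certified from
-- inequalities alone, whatever the ground set. Once a list is exhausted, nothing remains to be
-- compared.
data Merge : List ℕ → List ℕ → Word → Set where
  []    : Merge [] [] []
  restᴬ : ∀ {x xs w} → Merge xs [] w → Merge (x ∷ xs) [] (A ∷ w)
  restᴮ : ∀ {y ys w} → Merge [] ys w → Merge [] (y ∷ ys) (B ∷ w)
  stepᴬ : ∀ {x xs y ys w} → x < y → Merge xs (y ∷ ys) w → Merge (x ∷ xs) (y ∷ ys) (A ∷ w)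
  stepᴮ : ∀ {x xs y ys w} → y < x → Merge (x ∷ xs) ys w → Merge (x ∷ xs) (y ∷ ys) (B ∷ w)

-- Treats an exhausted and a nonempty `ys` at once, sparing `word-unique` that split.
Merge-headᴬ : ∀ {x xs ys w} → All (x <_) ys → Merge (x ∷ xs) ys w →
  ∃ λ w′ → w ≡ A ∷ w′ × Merge xs ys w′
Merge-headᴬ _         (restᴬ m)     = _ , refl , m
Merge-headᴬ _         (stepᴬ _ m)   = _ , refl , m
Merge-headᴬ (x<y ∷ _) (stepᴮ y<x _) = ⊥-elim (<-asym x<y y<x)

Merge-headᴮ : ∀ {xs y ys w} → All (y <_) xs → Merge xs (y ∷ ys) w →
  ∃ λ w′ → w ≡ B ∷ w′ × Merge xs ys w′
Merge-headᴮ _         (restᴮ m)     = _ , refl , m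
Merge-headᴮ _         (stepᴮ _ m)   = _ , refl , m
Merge-headᴮ (y<x ∷ _) (stepᴬ x<y _) = ⊥-elim (<-asym x<y y<x)

-- `k` is the number of the first vertex still to be scanned, so entries keep their absolute numbers
-- through the recursion.
positions : ℕ → Subset m → List ℕ
positions k []            = []
positions k (inside  ∷ p) = k ∷ positions (suc k) p
positions k (outside ∷ p) = positions (suc k) p

positions-≥ : ∀ k (p : Subset m) → All (k ≤_) (positions k p)
positions-≥ k []            = []
positions-≥ k (inside  ∷ p) = ≤-refl ∷ All.map <⇒≤ (positions-≥ (suc k) p)
positions-≥ k (outside ∷ p) = All.map <⇒≤ (positions-≥ (suc k) p)

positions-increasing : ∀ k (p : Subset m) → AllPairs _<_ (positions k p)
positions-increasing k []            = []
positions-increasing k (inside  ∷ p) = positions-≥ (suc k) p ∷ positions-increasing (suc k) p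
positions-increasing k (outside ∷ p) = positions-increasing (suc k) p

length-positions : ∀ k (p : Subset m) → length (positions k p) ≡ ∣ p ∣
length-positions k []            = refl
length-positions k (inside  ∷ p) = cong suc (length-positions (suc k) p)
length-positions k (outside ∷ p) = length-positions (suc k) p

-- Both scans advance in step, and past vertex `k` all entries are at least `suc k`; so equal
-- entries come from the same vertex.
positions-common : ∀ k (p q : Subset m) {x} →
  x ∈ positions k p → x ∈ positions k q → Nonempty (p ∩ q)
positions-common k (inside  ∷ p) (inside  ∷ q) _ _ = zero , here
positions-common k (inside  ∷ p) (outside ∷ q) (here refl) x∈q =
  ⊥-elim (<-irrefl refl (All.lookup (positions-≥ (suc k) q) x∈q))
positions-common k (outside ∷ p) (inside  ∷ q) x∈p (here refl) =
  ⊥-elim (<-irrefl refl (All.lookup (positions-≥ (suc k) p) x∈p))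
positions-common k (inside  ∷ p) (outside ∷ q) (there x∈p) x∈q
  with i , i∈ ← positions-common (suc k) p q x∈p x∈q = suc i , there i∈
positions-common k (outside ∷ p) (inside  ∷ q) x∈p (there x∈q)
  with i , i∈ ← positions-common (suc k) p q x∈p x∈q = suc i , there i∈
positions-common k (outside ∷ p) (outside ∷ q) x∈p x∈q
  with i , i∈ ← positions-common (suc k) p q x∈p x∈q = suc i , there i∈

-- All later positions exceed `k`, so a vertex `k` in one subset forces the head of the merge. At a
-- common vertex no merge exists, as either step would need `k < k`.
word-unique : ∀ k (p q : Subset m) {w} →
  Merge (positions k p) (positions k q) w → word p q ≡ w
word-unique k []            []            []            = refl
word-unique k (inside  ∷ p) (inside  ∷ q) (stepᴬ k<k _) = ⊥-elim (<-irrefl refl k<k)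
word-unique k (inside  ∷ p) (inside  ∷ q) (stepᴮ k<k _) = ⊥-elim (<-irrefl refl k<k)
word-unique k (inside  ∷ p) (outside ∷ q) m
  with _ , refl , m′ ← Merge-headᴬ (positions-≥ (suc k) q) m = cong (A ∷_) (word-unique (suc k) p q m′)
word-unique k (outside ∷ p) (inside  ∷ q) m
  with _ , refl , m′ ← Merge-headᴮ (positions-≥ (suc k) p) m = cong (B ∷_) (word-unique (suc k) p q m′)
word-unique k (outside ∷ p) (outside ∷ q) m = word-unique (suc k) p q m

-- From edge shapes to words of triples

record Vertices (p : Subset m) : Set where
  constructor vertices
  field
    {x y z}     : ℕ
    x<y         : x < y
    y<z         : y < z
    positions-≡ : positions 0 p ≡ x ∷ y ∷ z ∷ []

  xy yz : Edge
  xy = edge x<y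
  yz = edge y<z

open Vertices

triple-vertices : (p : Subset m) → ∣ p ∣ ≡ 3 → Vertices p
triple-vertices p ∣p∣≡3
  with positions 0 p in eq | positions-increasing 0 p | trans (length-positions 0 p) ∣p∣≡3
... | _ ∷ _ ∷ _ ∷ [] | (x<y ∷ _) ∷ (y<z ∷ _) ∷ _ | refl = vertices x<y y<z eq

module _ {p q : Subset m} (P : Vertices p) (Q : Vertices q) (disj : Empty (p ∩ q)) where

  private
    distinct : ∀ {u v} → u ∈ x P ∷ y P ∷ z P ∷ [] → v ∈ x Q ∷ y Q ∷ z Q ∷ [] → u ≢ v
    distinct {u} u∈ v∈ refl = disj $ positions-common 0 p q {u}
      (subst (u ∈_) (sym (positions-≡ P)) u∈) (subst (u ∈_) (sym (positions-≡ Q)) v∈)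

    pattern 1st = here refl
    pattern 2nd = there (here refl)
    pattern 3rd = there (there (here refl))

  xy-disjoint : DisjointEdges (xy P) (xy Q)
  xy-disjoint = record
    { ll = distinct 1st 1st ; lr = distinct 1st 2nd ; rl = distinct 2nd 1st ; rr = distinct 2nd 2nd }

  yz-disjoint : DisjointEdges (yz P) (yz Q)
  yz-disjoint = record
    { ll = distinct 2nd 2nd ; lr = distinct 2nd 3rd ; rl = distinct 3rd 2nd ; rr = distinct 3rd 3rd }

  zx-distinct : z P ≢ x Q
  zx-distinct = distinct 3rd 1st

  word-≡ : ∀ {w} → Merge (x P ∷ y P ∷ z P ∷ []) (x Q ∷ y Q ∷ z Q ∷ []) w → word p q ≡ w
  word-≡ m = word-unique 0 p q $
    subst (λ qs → Merge (positions 0 p) qs _) (sym (positions-≡ Q)) $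
    subst (λ ps → Merge ps _ _) (sym (positions-≡ P)) m

-- Shapes `L` and `L` leave one comparison open: the last vertex of the first triple against the
-- first vertex of the second. It separates alignment from engagement; any other pair of shapes
-- determines the word.
WordOfShapes : Shape → Shape → Word → Set
WordOfShapes X Y w = w ≡ pattern-word X Y ⊎ ((X , Y) ≡ (L , L) × w ≡ engagement-word)

left-order : ∀ {e f} X → e ⟨ X ⟩ f → left e < left f
left-order {e} L e<f   = <-trans (left<right e) e<f
left-order S (l< , _) = l<
left-order W (l< , _) = l<

module _ {p q : Subset m} (P : Vertices p) (Q : Vertices q) (disj : Empty (p ∩ q)) where

  -- The xy-shape already orders y P and y Q, hence orients the yz-shape.
  word-of-shapes : ∀ X Y → xy P ⟨ X ⟩ xy Q → yz P ~⟨ Y ⟩ yz Q → WordOfShapes X Y (word p q)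
  word-of-shapes L Y y<x (inj₂ b) =
    ⊥-elim (<-asym (<-trans y<x (x<y Q)) (left-order Y b))
  word-of-shapes W Y (_ , _ , y<y) (inj₂ b) = ⊥-elim (<-asym y<y (left-order Y b))
  -- Nesting reverses the middle vertices, so after `S` the yz-edge of `Q` comes first and only
  -- `inj₂` survives.
  word-of-shapes S Y (_ , y>y) (inj₁ b) = ⊥-elim (<-asym y>y (left-order Y b))
  word-of-shapes L L y<x (inj₁ z<y) with <-cmp (z P) (x Q)
  ... | tri< z<x _ _ = inj₁ $ word-≡ P Q disj
    (stepᴬ (<-trans (x<y P) y<x) (stepᴬ y<x (stepᴬ z<x (restᴮ (restᴮ (restᴮ []))))))
  ... | tri≈ _ z≡x _ = ⊥-elim (zx-distinct P Q disj z≡x)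
  ... | tri> _ _ z>x = inj₂ $ refl , word-≡ P Q disj
    (stepᴬ (<-trans (x<y P) y<x) (stepᴬ y<x (stepᴮ z>x (stepᴬ z<y (restᴮ (restᴮ []))))))
  word-of-shapes L S y<x (inj₁ (_ , z>z)) = inj₁ $ word-≡ P Q disj
    (stepᴬ (<-trans (x<y P) y<x) (stepᴬ y<x
    (stepᴮ (<-trans (x<y Q) (<-trans (y<z Q) z>z)) (stepᴮ (<-trans (y<z Q) z>z) (stepᴮ z>z (restᴬ []))))))
  word-of-shapes L W y<x (inj₁ (_ , y<z′ , z<z)) = inj₁ $ word-≡ P Q disj
    (stepᴬ (<-trans (x<y P) y<x) (stepᴬ y<x
    (stepᴮ (<-trans (x<y Q) y<z′) (stepᴮ y<z′ (stepᴬ z<z (restᴮ []))))))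
  word-of-shapes S L (x<x , y>y) (inj₂ z<y) = inj₁ $ word-≡ P Q disj
    (stepᴬ x<x (stepᴮ (<-trans (x<y Q) y>y) (stepᴮ y>y (stepᴮ z<y (restᴬ (restᴬ []))))))
  word-of-shapes S S (x<x , y>y) (inj₂ (_ , z<z)) = inj₁ $ word-≡ P Q disj
    (stepᴬ x<x (stepᴮ (<-trans (x<y Q) y>y) (stepᴮ y>y
    (stepᴬ (<-trans (y<z P) z<z) (stepᴬ z<z (restᴮ []))))))
  word-of-shapes S W (x<x , y>y) (inj₂ (_ , y<z′ , z>z)) = inj₁ $ word-≡ P Q disj
    (stepᴬ x<x (stepᴮ (<-trans (x<y Q) y>y) (stepᴮ y>y (stepᴬ y<z′ (stepᴮ z>z (restᴬ []))))))
  word-of-shapes W L (x<x , x<y′ , y<y) (inj₁ z<y) = inj₁ $ word-≡ P Q disj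
    (stepᴬ x<x (stepᴮ x<y′ (stepᴬ y<y (stepᴬ z<y (restᴮ (restᴮ []))))))
  word-of-shapes W S (x<x , x<y′ , y<y) (inj₁ (_ , z>z)) = inj₁ $ word-≡ P Q disj
    (stepᴬ x<x (stepᴮ x<y′ (stepᴬ y<y (stepᴮ (<-trans (y<z Q) z>z) (stepᴮ z>z (restᴬ []))))))
  word-of-shapes W W (x<x , x<y′ , y<y) (inj₁ (_ , y<z′ , z<z)) = inj₁ $ word-≡ P Q disj
    (stepᴬ x<x (stepᴮ x<y′ (stepᴬ y<y (stepᴮ y<z′ (stepᴬ z<z (restᴮ []))))))

ShapesRelated : Shape → Shape → Rel (Subset m) 0ℓ
ShapesRelated X Y p q = WordOfShapes X Y (word p q) ⊎ WordOfShapes X Y (word q p)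

-- Sub-matchings from lists of indices

subset : List (Fin n) → Subset n
subset []       = ∅
subset (i ∷ is) = subset is [ i ]≔ inside

∣insert∣ : (p : Subset n) (i : Fin n) → i ∉ˢ p → ∣ p [ i ]≔ inside ∣ ≡ suc ∣ p ∣
∣insert∣ (inside  ∷ p) zero    i∉p = ⊥-elim (i∉p here)
∣insert∣ (outside ∷ p) zero    i∉p = refl
∣insert∣ (inside  ∷ p) (suc i) i∉p = cong suc (∣insert∣ p i (i∉p ∘ there))
∣insert∣ (outside ∷ p) (suc i) i∉p = ∣insert∣ p i (i∉p ∘ there)

∈-insert⁻ : (p : Subset n) (i : Fin n) {j : Fin n} → j ∈ˢ p [ i ]≔ inside → j ≡ i ⊎ j ∈ˢ p
∈-insert⁻ (_ ∷ p) zero    here       = inj₁ refl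
∈-insert⁻ (_ ∷ p) zero    (there j∈) = inj₂ (there j∈)
∈-insert⁻ (_ ∷ p) (suc i) here       = inj₂ here
∈-insert⁻ (_ ∷ p) (suc i) (there j∈) = Sum.map (cong suc) there (∈-insert⁻ p i j∈)

∈-subset⁻ : (is : List (Fin n)) {j : Fin n} → j ∈ˢ subset is → j ∈ is
∈-subset⁻ []       j∈ = ⊥-elim (∉⊥ j∈)
∈-subset⁻ (i ∷ is) j∈ = [ here , there ∘ ∈-subset⁻ is ]′ (∈-insert⁻ (subset is) i j∈)

-- Uniqueness makes each inserted index new, so every insertion raises the cardinality.
∣subset∣ : {is : List (Fin n)} → Unique is → ∣ subset is ∣ ≡ length is
∣subset∣ {n = n} [] = ∣⊥∣≡0 n
∣subset∣ (i≢ ∷ u) = trans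
  (∣insert∣ _ _ λ i∈ → All.lookup i≢ (∈-subset⁻ _ i∈) refl) (cong suc (∣subset∣ u))

clique-submatching : (M : Matching n) {_~_ : Rel (Subset (3 * n)) 0ℓ} {k : ℕ} {xs : List (Fin n)} →
  Clique (λ i j → triple M i ~ triple M j) (suc k) xs → ContainsOfSize M (k + 1) (EveryTwo M _~_)
clique-submatching M {k = k} c =
  subset (members c) ,
  trans (∣subset∣ (unique c)) (trans (length≡ c) (+-comm 1 k)) ,
  λ i∈ j∈ → related c (∈-subset⁻ _ i∈) (∈-subset⁻ _ j∈)

-- The product bound and the assembly of the theorem

row : (Shape → Shape → ℕ) → Shape → ℕ
row a X = a X L * (a X S * a X W)

-- `product` unfolds to nine factors nested to the right and ending in `1`; `split` gathers three of
-- them at a time, the final `1` being its remainder for `W`.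
∏-rows : ∀ a → ∏ a ≡ row a L * (row a S * row a W)
∏-rows a = begin
  ∏ a                                   ≡⟨ split L _ ⟩
  row a L * _                           ≡⟨ cong (row a L *_) (split S _) ⟩
  row a L * (row a S * _)               ≡⟨ cong (λ r → row a L * (row a S * r)) (split W 1) ⟩
  row a L * (row a S * (row a W * 1))   ≡⟨ cong (λ r → row a L * (row a S * r)) (*-identityʳ _) ⟩
  row a L * (row a S * row a W)         ∎
  where
  open ≡-Reasoning
  split : ∀ X r → a X L * (a X S * (a X W * r)) ≡ row a X * r
  split X r = begin
    a X L * (a X S * (a X W * r)) ≡⟨ cong (a X L *_) (*-assoc (a X S) (a X W) r) ⟨
    a X L * (a X S * a X W * r)   ≡⟨ *-assoc (a X L) (a X S * a X W) r ⟨
    row a X * r                   ∎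

theorem5 : (a : Shape → Shape → ℕ) → (∀ X Y → a X Y > 0) →
    (n : ℕ) → n ≡ ∏ a + 1 →
    (M : Matching n) →
    ContainsOfSize M (a L L + 1) (IsSemiLine M)
    ⊎ ∃₂ (λ X Y → (X , Y) ≢ (L , L) × ContainsOfSize M (a X Y + 1) (EveryTwo M (R X Y)))
theorem5 a _ n n≡ M = let X , Y , c = shapes-clique in conclude X Y c
  where
  V : ∀ i → Vertices (triple M i)
  V i = triple-vertices (triple M i) (size M i)

  rows<n : row a L * (row a S * row a W) < length (allFin n)
  rows<n = ≤-reflexive $ sym $ begin
    length (allFin n)                   ≡⟨ length-tabulate id ⟩
    n                                   ≡⟨ n≡ ⟩
    ∏ a + 1                             ≡⟨ +-comm (∏ a) 1 ⟩
    suc (∏ a)                           ≡⟨ cong suc (∏-rows a) ⟩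
    suc (row a L * (row a S * row a W)) ∎
    where open ≡-Reasoning

  shapes-clique : ∃₂ λ X Y →
    Clique (λ i j → ShapesRelated X Y (triple M i) (triple M j)) (suc (a X Y)) (allFin n)
  shapes-clique =
    let X , c = homogeneous-clique (xy ∘ V) (λ i≢j → xy-disjoint (V _) (V _) (disjoint M i≢j))
                  (row a) (allFin n) (Unique.allFin⁺ n) rows<n
        -- `c` has `suc (row a X)` members, and `row a X` is by definition the bound for `s = a X`.
        Y , d = homogeneous-clique (yz ∘ V) (λ i≢j → yz-disjoint (V _) (V _) (disjoint M i≢j))
                  (a X) (members c) (unique c) (≤-reflexive (sym (length≡ c)))
    in X , Y , clique-map (within c) d λ i∈ j∈ i≢j yz~ → Sum.map
         (λ xy~ → word-of-shapes (V _) (V _) (disjoint M i≢j) X Y xy~ yz~)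
         -- If `j` comes first on the xy-edges, the triples exchange roles, and `yz~` has to be read
         -- from that side as well.
         (λ xy~ → word-of-shapes (V _) (V _) (disjoint M (≢-sym i≢j)) X Y xy~ (swap yz~))
         (related c (within d i∈) (within d j∈) i≢j)

  -- A regrouping: `ShapesRelated` chooses the order of the triples first and the word second, the
  -- goal the other way round.
  semi-line : ∀ (p q : Subset (3 * n)) → ShapesRelated L L p q → R L L p q ⊎ R*LL p q
  semi-line _ _ (inj₁ (inj₁ w))       = inj₁ (inj₁ w)
  semi-line _ _ (inj₁ (inj₂ (_ , w))) = inj₂ (inj₁ w)
  semi-line _ _ (inj₂ (inj₁ w))       = inj₁ (inj₂ w)
  semi-line _ _ (inj₂ (inj₂ (_ , w))) = inj₂ (inj₂ w)

  pattern-related : ∀ {X Y} → (X , Y) ≢ (L , L) → (p q : Subset (3 * n)) →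
    ShapesRelated X Y p q → R X Y p q
  pattern-related ≢LL _ _ = Sum.map pattern-only pattern-only
    where
    pattern-only : ∀ {w} → WordOfShapes _ _ w → w ≡ pattern-word _ _
    pattern-only = [ id , (λ (≡LL , _) → ⊥-elim (≢LL ≡LL)) ]′

  -- Keeps the eight pairs other than `(L , L)` in a single branch of `conclude`, where the
  -- engagement word is excluded.
  LL? : ∀ X Y → (X , Y) ≡ (L , L) ⊎ (X , Y) ≢ (L , L)
  LL? L L = inj₁ refl
  LL? L S = inj₂ λ ()
  LL? L W = inj₂ λ ()
  LL? S _ = inj₂ λ ()
  LL? W _ = inj₂ λ ()

  conclude : ∀ X Y →
    Clique (λ i j → ShapesRelated X Y (triple M i) (triple M j)) (suc (a X Y)) (allFin n) →
    ContainsOfSize M (a L L + 1) (IsSemiLine M)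
    ⊎ ∃₂ (λ X Y → (X , Y) ≢ (L , L) × ContainsOfSize M (a X Y + 1) (EveryTwo M (R X Y)))
  conclude X Y c with LL? X Y
  ... | inj₁ refl = inj₁ $
    clique-submatching M {λ p q → R L L p q ⊎ R*LL p q} (clique-map id c λ {i} {j} _ _ _ → semi-line (triple M i) (triple M j))
  ... | inj₂ ≢LL  = inj₂ $ X , Y , ≢LL ,
    clique-submatching M {R X Y} (clique-map id c λ {i} {j} _ _ _ → pattern-related ≢LL (triple M i) (triple M j))
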